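{- Let $n\geq 1$, let $(\mathbf{d},\mathbf{r})$ be an arithmetical structure on the star graph $S_n$, and let $\mathcal{K}(S_n;\mathbf{d},\mathbf{r})$ be its critical group. Then \[\mathcal{K}(S_n;\mathbf{d},\mathbf{r})\oplus (\mathbb{Z}/r_0\mathbb{Z})^2 \cong \bigoplus_{i=1}^n \mathbb{Z}/d_i\mathbb{Z},\] where $r_0=\operatorname{lcm}(d_1, d_2, \dotsc, d_n)$.
   Context: An arithmetical structure on a finite, connected, loopless graph $G$ with vertex set $V(G)$ is a pair $(\mathbf{d},\mathbf{r})$, where $\mathbf{r}=(r_v)_{v\in V(G)}$ consists of positive integers with no common factor, $\mathbf{d}=(d_v)_{v\in V(G)}$ consists of nonnegative integers, and for every vertex $v$ we have $r_vd_v=\sum r_u$, the sum being over all $u$ adjacent to $v$ (with multiplicity for multigraphs). Its critical group $\mathcal{K}(G;\mathbf{d},\mathbf{r})$ is the torsion part of the cokernel (over $\mathbb{Z}$) of the matrix $L(G,\mathbf{d})=\operatorname{diag}(\mathbf{d})-A(G)$, where $A(G)$ is the adjacency matrix of $G$. The star graph $S_n$ has $n$ leaves $v_1,\dotsc,v_n$, each joined by one edge to a central vertex $v_0$ (and no other edges). Write $d_i=d_{v_i}$ and $r_i=r_{v_i}$; in particular $r_0$ is the $\mathbf{r}$-value at the central vertex, and it equals $\operatorname{lcm}(d_1,\dotsc,d_n)$. -}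

module Defs where

open import Algebra.Bundles using (AbelianGroup)
import Algebra.Construct.DirectProduct as DirectProduct
import Algebra.Construct.Pointwise as Pointwise
open import Algebra.Morphism.Structures using (module GroupMorphisms)
import Algebra.Properties.AbelianGroup as AbelianGroupProperties
import Algebra.Properties.CommutativeMonoid.Mult as Multiples
import Algebra.Properties.CommutativeSemigroup as CommutativeSemigroupProperties
import Algebra.Properties.Group as GroupProperties
import Algebra.Properties.Semiring.Sum as SemiringSum
open import Data.Bool.Base using (if_then_else_)
open import Data.Fin.Base using (Fin; zero; suc)
open import Data.Fin.Properties using (_≟_)
open import Data.Integer.Base as ℤ using (ℤ; +_; 0ℤ)
open import Data.Integer.Divisibility.Signed as ℤ∣ using ()
import Data.Integer.Properties as ℤ
open import Data.Nat.Base as ℕ using (ℕ; zero; suc; NonZero)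
open import Data.Nat.Divisibility as ℕ∣ using ()
open import Data.Nat.LCM using (lcm)
import Data.Nat.Properties as ℕ
open import Data.Product.Base using (Σ; ∃; _,_; proj₁; proj₂)
open import Data.Vec.Functional using (Vector; foldr)
open import Level using (Level; _⊔_; 0ℓ)
open import Relation.Binary.Construct.Closure.ReflexiveTransitive
  using (Star; _◅_) renaming (ε to stop)
open import Relation.Binary.PropositionalEquality
  using (_≡_; refl; sym; trans; cong; cong₂; module ≡-Reasoning)
open import Relation.Nullary.Decidable using (does)

private
  module ℕΣ = SemiringSum ℕ.+-*-semiring
  module ℤΣ = SemiringSum ℤ.+-*-semiring

infix 4 _≅_
infixr 6 _⊕_

_≅_ : ∀ {a ℓ₁ b ℓ₂} → AbelianGroup a ℓ₁ → AbelianGroup b ℓ₂ → Set (a ⊔ ℓ₁ ⊔ b ⊔ ℓ₂)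
G ≅ H = ∃ (GroupMorphisms.IsGroupIsomorphism (rawGroup G) (rawGroup H))
  where open AbelianGroup using (rawGroup)

_⊕_ : ∀ {a ℓ₁ b ℓ₂} → AbelianGroup a ℓ₁ → AbelianGroup b ℓ₂ →
      AbelianGroup (a ⊔ b) (ℓ₁ ⊔ ℓ₂)
_⊕_ = DirectProduct.abelianGroup

⨁ : ∀ {a ℓ} {n : ℕ} → (Fin n → AbelianGroup a ℓ) → AbelianGroup a ℓ
⨁ {n = n} G = record
  { Carrier = ∀ i → G.Carrier i
  ; _≈_ = λ x y → ∀ i → G._≈_ i (x i) (y i)
  ; _∙_ = λ x y i → G._∙_ i (x i) (y i)
  ; ε = λ i → G.ε i
  ; _⁻¹ = λ x i → G._⁻¹ i (x i)
  ; isAbelianGroup = record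
    { isGroup = record
      { isMonoid = record
        { isSemigroup = record
          { isMagma = record
            { isEquivalence = record
              { refl = λ i → G.refl i
              ; sym = λ p i → G.sym i (p i)
              ; trans = λ p q i → G.trans i (p i) (q i)
              }
            ; ∙-cong = λ p q i → G.∙-cong i (p i) (q i)
            }
          ; assoc = λ x y z i → G.assoc i (x i) (y i) (z i)
          }
        ; identity = (λ x i → G.identityˡ i (x i)) , (λ x i → G.identityʳ i (x i))
        }
      ; inverse = (λ x i → G.inverseˡ i (x i)) , (λ x i → G.inverseʳ i (x i))
      ; ⁻¹-cong = λ p i → G.⁻¹-cong i (p i)
      }
    ; comm = λ x y i → G.comm i (x i) (y i)
    }
  }
  where module G (i : Fin n) = AbelianGroup (G i)

module _ {a ℓ} (G : AbelianGroup a ℓ) where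
  open AbelianGroup G

  record IsSubgroup {p} (P : Carrier → Set p) : Set (a ⊔ ℓ ⊔ p) where
    field
      resp      : ∀ {x y} → x ≈ y → P x → P y
      ε-closed  : P ε
      ∙-closed  : ∀ {x y} → P x → P y → P (x ∙ y)
      ⁻¹-closed : ∀ {x} → P x → P (x ⁻¹)

  subgroup : ∀ {p} {P : Carrier → Set p} → IsSubgroup P → AbelianGroup (a ⊔ p) ℓ
  subgroup {P = P} H = record
    { Carrier = Σ Carrier P
    ; _≈_ = λ x y → proj₁ x ≈ proj₁ y
    ; _∙_ = λ (x , px) (y , py) → x ∙ y , ∙-closed px py
    ; ε = ε , ε-closed
    ; _⁻¹ = λ (x , px) → x ⁻¹ , ⁻¹-closed px
    ; isAbelianGroup = record
      { isGroup = record
        { isMonoid = record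
          { isSemigroup = record
            { isMagma = record
              { isEquivalence = record
                { refl = AbelianGroup.refl G
                ; sym = AbelianGroup.sym G
                ; trans = AbelianGroup.trans G
                }
              ; ∙-cong = ∙-cong
              }
            ; assoc = λ x y z → assoc (proj₁ x) (proj₁ y) (proj₁ z)
            }
          ; identity = (λ x → identityˡ (proj₁ x)) , (λ x → identityʳ (proj₁ x))
          }
        ; inverse = (λ x → inverseˡ (proj₁ x)) , (λ x → inverseʳ (proj₁ x))
        ; ⁻¹-cong = ⁻¹-cong
        }
      ; comm = λ x y → comm (proj₁ x) (proj₁ y)
      }
    }
    where open IsSubgroup H

  -- G modulo P keeps the carrier of G and identifies x with y when x - y lies in P.
  quotient : ∀ {p} {P : Carrier → Set p} → IsSubgroup P → AbelianGroup a p
  quotient {p} {P} H = record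
    { Carrier = Carrier
    ; _≈_ = _~_
    ; _∙_ = _∙_
    ; ε = ε
    ; _⁻¹ = _⁻¹
    ; isAbelianGroup = record
      { isGroup = record
        { isMonoid = record
          { isSemigroup = record
            { isMagma = record
              { isEquivalence = record
                { refl = ≈⇒~ (AbelianGroup.refl G)
                ; sym = λ {x} {y} q → resp (negate x y) (⁻¹-closed q)
                ; trans = λ {x} {y} {z} q r → resp (telescope x y z) (∙-closed q r)
                }
              ; ∙-cong = λ {x} {y} {u} {v} q r → resp (interchange x y u v) (∙-closed q r)
              }
            ; assoc = λ x y z → ≈⇒~ (assoc x y z)
            }
          ; identity = (λ x → ≈⇒~ (identityˡ x)) , (λ x → ≈⇒~ (identityʳ x))
          }
        ; inverse = (λ x → ≈⇒~ (inverseˡ x)) , (λ x → ≈⇒~ (inverseʳ x))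
        ; ⁻¹-cong = λ {x} {y} q → resp (AbelianGroup.sym G (⁻¹-∙-comm x (y ⁻¹))) (⁻¹-closed q)
        }
      ; comm = λ x y → ≈⇒~ (comm x y)
      }
    }
    where
    open IsSubgroup H
    open AbelianGroupProperties G using (⁻¹-∙-comm)
    open GroupProperties group using (⁻¹-involutive)
    open CommutativeSemigroupProperties commutativeSemigroup using () renaming (interchange to ∙-interchange)
    open import Relation.Binary.Reasoning.Setoid setoid

    _~_ : Carrier → Carrier → Set p
    x ~ y = P (x ∙ y ⁻¹)

    ≈⇒~ : ∀ {x y} → x ≈ y → x ~ y
    ≈⇒~ {x} {y} q = resp
      (AbelianGroup.sym G (AbelianGroup.trans G (∙-congʳ q) (inverseʳ y))) ε-closed

    negate : ∀ x y → (x ∙ y ⁻¹) ⁻¹ ≈ y ∙ x ⁻¹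
    negate x y = begin
      (x ∙ y ⁻¹) ⁻¹      ≈⟨ ⁻¹-∙-comm x (y ⁻¹) ⟨
      x ⁻¹ ∙ (y ⁻¹) ⁻¹   ≈⟨ ∙-congˡ (⁻¹-involutive y) ⟩
      x ⁻¹ ∙ y           ≈⟨ comm (x ⁻¹) y ⟩
      y ∙ x ⁻¹           ∎

    telescope : ∀ x y z → (x ∙ y ⁻¹) ∙ (y ∙ z ⁻¹) ≈ x ∙ z ⁻¹
    telescope x y z = begin
      (x ∙ y ⁻¹) ∙ (y ∙ z ⁻¹)   ≈⟨ assoc x (y ⁻¹) (y ∙ z ⁻¹) ⟩
      x ∙ (y ⁻¹ ∙ (y ∙ z ⁻¹))   ≈⟨ ∙-congˡ (assoc (y ⁻¹) y (z ⁻¹)) ⟨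
      x ∙ ((y ⁻¹ ∙ y) ∙ z ⁻¹)   ≈⟨ ∙-congˡ (∙-congʳ (inverseˡ y)) ⟩
      x ∙ (ε ∙ z ⁻¹)            ≈⟨ ∙-congˡ (identityˡ (z ⁻¹)) ⟩
      x ∙ z ⁻¹                  ∎

    interchange : ∀ x y u v → (x ∙ y ⁻¹) ∙ (u ∙ v ⁻¹) ≈ (x ∙ u) ∙ (y ∙ v) ⁻¹
    interchange x y u v = begin
      (x ∙ y ⁻¹) ∙ (u ∙ v ⁻¹)   ≈⟨ ∙-interchange x (y ⁻¹) u (v ⁻¹) ⟩
      (x ∙ u) ∙ (y ⁻¹ ∙ v ⁻¹)   ≈⟨ ∙-congˡ (⁻¹-∙-comm y v) ⟩
      (x ∙ u) ∙ (y ∙ v) ⁻¹      ∎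

  open Multiples commutativeMonoid using (_×_; ×-congʳ; ×-distrib-+; ×-assocˡ; ×-congˡ)

  IsTorsion : Carrier → Set ℓ
  IsTorsion x = ∃ λ k → suc k × x ≈ ε

  torsion-isSubgroup : IsSubgroup IsTorsion
  torsion-isSubgroup = record
    { resp = λ q (k , e) → k , AbelianGroup.trans G (×-congʳ (suc k) (AbelianGroup.sym G q)) e
    ; ε-closed = 0 , identityʳ ε
    ; ∙-closed = λ {x} {y} (k , e) (l , f) → l ℕ.+ k ℕ.* suc l , (begin
        (suc k ℕ.* suc l) × (x ∙ y)                         ≈⟨ ×-distrib-+ x y (suc k ℕ.* suc l) ⟩
        (suc k ℕ.* suc l) × x ∙ (suc k ℕ.* suc l) × y       ≈⟨ ∙-cong
          (AbelianGroup.trans G (×-congˡ (ℕ.*-comm (suc k) (suc l))) (kill (suc l) (suc k) e))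
          (kill (suc k) (suc l) f) ⟩
        ε ∙ ε                                               ≈⟨ identityʳ ε ⟩
        ε                                                   ∎)
    ; ⁻¹-closed = λ {x} (k , e) → k , (begin
        suc k × (x ⁻¹)                      ≈⟨ identityʳ (suc k × (x ⁻¹)) ⟨
        suc k × (x ⁻¹) ∙ ε                  ≈⟨ ∙-congˡ e ⟨
        suc k × (x ⁻¹) ∙ suc k × x          ≈⟨ ×-distrib-+ (x ⁻¹) x (suc k) ⟨
        suc k × (x ⁻¹ ∙ x)                ≈⟨ ×-congʳ (suc k) (inverseˡ x) ⟩
        suc k × ε                         ≈⟨ ×-ε (suc k) ⟩
        ε                                 ∎)
    }
    where
    open import Relation.Binary.Reasoning.Setoid setoid

    ×-ε : ∀ m → m × ε ≈ ε
    ×-ε zero    = AbelianGroup.refl G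
    ×-ε (suc m) = AbelianGroup.trans G (identityˡ (m × ε)) (×-ε m)

    kill : ∀ m n {x} → n × x ≈ ε → (m ℕ.* n) × x ≈ ε
    kill m n {x} e = begin
      (m ℕ.* n) × x   ≈⟨ ×-assocˡ x m n ⟨
      m × (n × x)     ≈⟨ ×-congʳ m e ⟩
      m × ε           ≈⟨ ×-ε m ⟩
      ε               ∎

  torsion : AbelianGroup (a ⊔ ℓ) ℓ
  torsion = subgroup torsion-isSubgroup

multiples-isSubgroup : ∀ d → IsSubgroup ℤ.+-0-abelianGroup (+ d ℤ∣.∣_)
multiples-isSubgroup d = record
  { resp = λ { refl p → p }
  ; ε-closed = ℤ∣.divides 0ℤ refl
  ; ∙-closed = ℤ∣.∣m∣n⇒∣m+n
  ; ⁻¹-closed = ℤ∣.∣m⇒∣-m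
  }

ℤ/_ : ℕ → AbelianGroup 0ℓ 0ℓ
ℤ/ d = quotient ℤ.+-0-abelianGroup (multiples-isSubgroup d)

infix 8 ℤ/_

ℤ^_ : ℕ → AbelianGroup 0ℓ 0ℓ
ℤ^ n = Pointwise.abelianGroup (Fin n) ℤ.+-0-abelianGroup

Matrix : ℕ → ℕ → Set
Matrix m n = Fin m → Fin n → ℤ

infixr 7 _*ᵥ_

_*ᵥ_ : ∀ {m n} → Matrix m n → Vector ℤ n → Vector ℤ m
(M *ᵥ x) i = ℤΣ.∑[ j < _ ] (M i j ℤ.* x j)

InImage : ∀ {m n} → Matrix m n → Vector ℤ m → Set
InImage M y = ∃ λ x → ∀ i → y i ≡ (M *ᵥ x) i

image-isSubgroup : ∀ {m n} (M : Matrix m n) → IsSubgroup (ℤ^ m) (InImage M)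
image-isSubgroup {m} {n} M = record
  { resp = λ p (x , e) → x , λ i → trans (sym (p i)) (e i)
  ; ε-closed = (λ _ → 0ℤ) , λ i → sym (*ᵥ-zero i)
  ; ∙-closed = λ (x , e) (y , f) → (λ j → x j ℤ.+ y j) ,
      λ i → trans (cong₂ ℤ._+_ (e i) (f i)) (sym (*ᵥ-+ x y i))
  ; ⁻¹-closed = λ (x , e) → (λ j → ℤ.- x j) ,
      λ i → trans (cong ℤ.-_ (e i)) (sym (*ᵥ-neg x i))
  }
  where
  open ≡-Reasoning

  *ᵥ-+ : ∀ x y i → (M *ᵥ (λ j → x j ℤ.+ y j)) i ≡ (M *ᵥ x) i ℤ.+ (M *ᵥ y) i
  *ᵥ-+ x y i = trans
    (ℤΣ.sum-cong-≗ λ j → ℤ.*-distribˡ-+ (M i j) (x j) (y j))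
    (ℤΣ.∑-distrib-+ (λ j → M i j ℤ.* x j) (λ j → M i j ℤ.* y j))

  *ᵥ-zero : ∀ i → (M *ᵥ (λ _ → 0ℤ)) i ≡ 0ℤ
  *ᵥ-zero i = trans (ℤΣ.sum-cong-≗ λ j → ℤ.*-zeroʳ (M i j)) (ℤΣ.sum-replicate-zero n)

  *ᵥ-neg : ∀ x i → (M *ᵥ (λ j → ℤ.- x j)) i ≡ ℤ.- (M *ᵥ x) i
  *ᵥ-neg x i = begin
    (M *ᵥ (λ j → ℤ.- x j)) i
      ≡⟨ ℤΣ.sum-cong-≗ (λ j → trans (sym (ℤ.neg-distribʳ-* (M i j) (x j)))
           (sym (ℤ.-1*i≡-i (M i j ℤ.* x j)))) ⟩
    ℤΣ.∑[ j < n ] (ℤ.-1ℤ ℤ.* (M i j ℤ.* x j))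
      ≡⟨ ℤΣ.*-distribˡ-sum ℤ.-1ℤ (λ j → M i j ℤ.* x j) ⟨
    ℤ.-1ℤ ℤ.* (M *ᵥ x) i
      ≡⟨ ℤ.-1*i≡-i ((M *ᵥ x) i) ⟩
    ℤ.- (M *ᵥ x) i
      ∎

cokernel : ∀ {m n} → Matrix m n → AbelianGroup 0ℓ 0ℓ
cokernel {m} M = quotient (ℤ^ m) (image-isSubgroup M)

-- Parallel edges are allowed: adj u v is the number of edges joining u and v.
-- (Star is reflexive-transitive closure here, not a star graph.)
record Graph : Set where
  field
    order         : ℕ
    .{{nonEmpty}} : NonZero order
    adj           : Fin order → Fin order → ℕ
    symmetric     : ∀ u v → adj u v ≡ adj v u
    loopless      : ∀ v → adj v v ≡ 0
    connected     : ∀ u v → Star (λ x y → 0 ℕ.< adj x y) u v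

record ArithmeticalStructure (G : Graph) : Set where
  open Graph G
  field
    d            : Vector ℕ order
    r            : Vector ℕ order
    r-positive   : ∀ v → 0 ℕ.< r v
    r-coprime    : ∀ k → (∀ v → k ℕ∣.∣ r v) → k ≡ 1
    arithmetical : ∀ v → r v ℕ.* d v ≡ ℕΣ.∑[ u < order ] (adj v u ℕ.* r u)

diag : ∀ {n} → Vector ℤ n → Matrix n n
diag x i j = if does (i ≟ j) then x i else 0ℤ

L : (G : Graph) → Vector ℕ (Graph.order G) → Matrix (Graph.order G) (Graph.order G)
L G d i j = diag (λ v → + d v) i j ℤ.- + Graph.adj G i j

criticalGroup : {G : Graph} → ArithmeticalStructure G → AbelianGroup 0ℓ 0ℓ
criticalGroup {G} A = torsion (cokernel (L G (ArithmeticalStructure.d A)))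

-- The centre v₀ is zero, and the leaf vᵢ is suc i with i counted from 0.
starAdj : ∀ {n} → Fin (suc n) → Fin (suc n) → ℕ
starAdj zero    zero    = 0
starAdj zero    (suc _) = 1
starAdj (suc _) zero    = 1
starAdj (suc _) (suc _) = 0

starGraph : ℕ → Graph
starGraph n = record
  { order     = suc n
  ; adj       = starAdj
  ; symmetric = symmetric
  ; loopless  = loopless
  ; connected = connected
  }
  where
  symmetric : (u v : Fin (suc n)) → starAdj u v ≡ starAdj v u
  symmetric zero    zero    = refl
  symmetric zero    (suc _) = refl
  symmetric (suc _) zero    = refl
  symmetric (suc _) (suc _) = refl

  loopless : (v : Fin (suc n)) → starAdj v v ≡ 0
  loopless zero    = refl
  loopless (suc _) = refl

  connected : (u v : Fin (suc n)) → Star (λ x y → 0 ℕ.< starAdj x y) u v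
  connected zero    zero    = stop
  connected zero    (suc _) = ℕ.z<s ◅ stop
  connected (suc _) zero    = ℕ.z<s ◅ stop
  connected (suc i) (suc j) = _◅_ {j = zero} ℕ.z<s (ℕ.z<s ◅ stop)

lcms : ∀ {n} → Vector ℕ n → ℕ
lcms = foldr lcm 1

-- Write N for r zero, ρᵢ for rᵢ₊₁, and M = ⨁ ℤ/dᵢ. Since ρᵢ dᵢ = N, the formula
-- B(x, y) = Σ ρᵢ xᵢ yᵢ is a well-defined symmetric bilinear form M × M → ℤ/N.
-- The vector s = (1, …, 1) is isotropic, because Σ ρᵢ = N d₀, and the Bézout
-- coefficients a of the coprime numbers ρᵢ satisfy B(s, a) = 1. So s and a span
-- a copy of (ℤ/N)² that splits off, with complement ⟨s, a⟩^⊥ ≅ s^⊥ / ⟨s⟩.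
-- The image of L lies in r^⊥ with finite index, so the critical group is
-- r^⊥ / im L, and forgetting the central coordinate identifies it with s^⊥ / ⟨s⟩.
module Submission where

open import Defs
open import Algebra.Bundles using (AbelianGroup)
open import Algebra.Morphism.Structures using (module GroupMorphisms)
import Algebra.Properties.Group as GroupProperties
import Algebra.Properties.Semiring.Sum as SemiringSum
open import Data.Bool.Base using (if_then_else_)
open import Data.Fin.Base using (Fin; zero; suc)
open import Data.Fin.Properties using (_≟_)
open import Data.Integer.Base as ℤ using (ℤ; +_; 0ℤ; 1ℤ)
open import Data.Integer.Divisibility.Signed as ℤ∣ using (divides)
import Data.Integer.Properties as ℤ
open import Data.Integer.Tactic.RingSolver using (solve-∀)
open import Data.Nat.Base as ℕ using (ℕ; _≥_)
open import Data.Nat.Divisibility as ℕ∣ using ()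
open import Data.Nat.GCD using (module Bézout; module GCD)
open import Data.Nat.LCM using (m∣lcm[m,n]; n∣lcm[m,n]; lcm-least)
import Data.Nat.Properties as ℕ
open import Data.Product.Base using (_×_; ∃; ∃₂; _,_; proj₁; proj₂)
open import Data.Vec.Functional using (Vector; tail; replicate; _∷_)
open import Function.Base using (_∘_)
open import Relation.Binary.PropositionalEquality
  using (_≡_; refl; sym; trans; cong; cong₂; subst; module ≡-Reasoning)
open import Relation.Nullary.Decidable using (does)

private
  module ℕΣ = SemiringSum ℕ.+-*-semiring
  module ℤΣ = SemiringSum ℤ.+-*-semiring

-- Isomorphisms of abelian groups.

module _ {a ℓ₁ b ℓ₂} (G : AbelianGroup a ℓ₁) (H : AbelianGroup b ℓ₂) where
  private
    module G = AbelianGroup G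
    module H = AbelianGroup H
    open GroupProperties G.group using () renaming (x∙y⁻¹≈ε⇒x≈y to G-diff)
    open GroupProperties H.group using () renaming (x∙y⁻¹≈ε⇒x≈y to H-diff; inverseˡ-unique to H-inverse)
  open GroupMorphisms G.rawGroup H.rawGroup

  -- For an additive map everything reduces to the identity through f (x y⁻¹) = f x (f y)⁻¹: `null`
  -- gives congruence and `kernel` gives injectivity. Compatibility with inverses is drawn from
  -- `null` as well, because congruence is deduced from it afterwards.
  additive⇒isomorphism : (f : G.Carrier → H.Carrier) →
    (∀ x y → f (x G.∙ y) H.≈ f x H.∙ f y) →
    (∀ x → x G.≈ G.ε → f x H.≈ H.ε) →
    (∀ x → f x H.≈ H.ε → x G.≈ G.ε) →
    (∀ y → ∃ λ x → f x H.≈ y) →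
    IsGroupIsomorphism f
  additive⇒isomorphism f homo null kernel surjective = record
    { isGroupMonomorphism = record
      { isGroupHomomorphism = record
        { isMonoidHomomorphism = record
          { isMagmaHomomorphism = record
            { isRelHomomorphism = record { cong = f-cong }
            ; homo = homo
            }
          ; ε-homo = null G.ε G.refl
          }
        ; ⁻¹-homo = ⁻¹-homo
        }
      ; injective = λ {x} {y} fx≈fy → G-diff x y (kernel (x G.∙ y G.⁻¹)
          (H.trans (minus x y) (H.trans (H.∙-congʳ fx≈fy) (H.inverseʳ (f y)))))
      }
    ; surjective = λ y → proj₁ (surjective y) ,
        λ z≈x → H.trans (f-cong z≈x) (proj₂ (surjective y))
    }
    where
    ⁻¹-homo : ∀ x → f (x G.⁻¹) H.≈ f x H.⁻¹
    ⁻¹-homo x = H-inverse (f (x G.⁻¹)) (f x)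
      (H.trans (H.sym (homo (x G.⁻¹) x)) (null (x G.⁻¹ G.∙ x) (G.inverseˡ x)))

    minus : ∀ x y → f (x G.∙ y G.⁻¹) H.≈ f x H.∙ f y H.⁻¹
    minus x y = H.trans (homo x (y G.⁻¹)) (H.∙-congˡ (⁻¹-homo y))

    f-cong : ∀ {x y} → x G.≈ y → f x H.≈ f y
    f-cong {x} {y} x≈y = H-diff (f x) (f y) (H.trans (H.sym (minus x y))
      (null (x G.∙ y G.⁻¹) (G.trans (G.∙-congʳ x≈y) (G.inverseʳ y))))

-- Integer pairings and finite sums.

⟨_,_⟩ : ∀ {n} → Vector ℤ n → Vector ℤ n → ℤ
⟨ w , x ⟩ = ℤΣ.∑[ i < _ ] (w i ℤ.* x i)

⟨⟩-congʳ : ∀ {n} (w : Vector ℤ n) {x y} → (∀ i → x i ≡ y i) → ⟨ w , x ⟩ ≡ ⟨ w , y ⟩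
⟨⟩-congʳ w x≗y = ℤΣ.sum-cong-≗ λ i → cong (w i ℤ.*_) (x≗y i)

⟨⟩-+ : ∀ {n} (w x y : Vector ℤ n) → ⟨ w , (λ i → x i ℤ.+ y i) ⟩ ≡ ⟨ w , x ⟩ ℤ.+ ⟨ w , y ⟩
⟨⟩-+ w x y = trans
  (ℤΣ.sum-cong-≗ λ i → ℤ.*-distribˡ-+ (w i) (x i) (y i))
  (ℤΣ.∑-distrib-+ (λ i → w i ℤ.* x i) (λ i → w i ℤ.* y i))

⟨⟩-* : ∀ {n} (w : Vector ℤ n) c x → ⟨ w , (λ i → c ℤ.* x i) ⟩ ≡ c ℤ.* ⟨ w , x ⟩
⟨⟩-* w c x = trans
  (ℤΣ.sum-cong-≗ λ i → swap (w i) c (x i))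
  (sym (ℤΣ.*-distribˡ-sum c (λ i → w i ℤ.* x i)))
  where
  swap : ∀ p q s → p ℤ.* (q ℤ.* s) ≡ q ℤ.* (p ℤ.* s)
  swap = solve-∀

⟨⟩-+* : ∀ {n} (w x : Vector ℤ n) c y →
  ⟨ w , (λ i → x i ℤ.+ c ℤ.* y i) ⟩ ≡ ⟨ w , x ⟩ ℤ.+ c ℤ.* ⟨ w , y ⟩
⟨⟩-+* w x c y = trans (⟨⟩-+ w x (λ i → c ℤ.* y i)) (cong (ℤ._+_ ⟨ w , x ⟩) (⟨⟩-* w c y))

-- The vector s.
𝟙 : ∀ {n} → Vector ℤ n
𝟙 = replicate _ 1ℤ

∑-zeroˡ : ∀ {n} (x : Vector ℤ n) → ⟨ replicate n 0ℤ , x ⟩ ≡ 0ℤ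
∑-zeroˡ {n} x = ℤΣ.sum-replicate-zero n

-- The summand is the form to which the leaf part of a leaf row of `L` unfolds; the trailing `0ℤ` is
-- the negated adjacency of two leaves.
∑-indicator : ∀ {n} (i : Fin n) c x →
  ⟨ (λ j → (if does (i ≟ j) then c else 0ℤ) ℤ.+ 0ℤ) , x ⟩ ≡ c ℤ.* x i
∑-indicator zero    c x = trans (cong₂ ℤ._+_ (cong (ℤ._* x zero) (ℤ.+-identityʳ c)) (∑-zeroˡ (tail x)))
                                (ℤ.+-identityʳ (c ℤ.* x zero))
∑-indicator (suc i) c x = trans (ℤ.+-identityˡ _) (∑-indicator i c (tail x))

pos-∑ : ∀ {n} (x : Vector ℕ n) → + (ℕΣ.sum x) ≡ ℤΣ.sum (λ i → + x i)
pos-∑ {ℕ.zero}  x = refl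
pos-∑ {ℕ.suc n} x = cong (ℤ._+_ (+ x zero)) (pos-∑ (tail x))

-- Bézout coefficients and least common multiples of families.

bézout : ∀ m n → ∃ λ g → g ℕ∣.∣ m × g ℕ∣.∣ n ×
  ∃₂ λ x y → + m ℤ.* x ℤ.+ + n ℤ.* y ≡ + g
bézout m n with Bézout.lemma m n
... | Bézout.result g isGCD b = g , GCD.gcd∣m isGCD , GCD.gcd∣n isGCD , coefficients b
  where
  rearrange : ∀ g m n x y → g ℤ.+ y ℤ.* n ≡ x ℤ.* m → m ℤ.* x ℤ.+ n ℤ.* ℤ.- y ≡ g
  rearrange g m n x y eq = begin
    m ℤ.* x ℤ.+ n ℤ.* ℤ.- y          ≡⟨ flip m n x y ⟩
    x ℤ.* m ℤ.+ ℤ.- (y ℤ.* n)        ≡⟨ cong (ℤ._+ ℤ.- (y ℤ.* n)) eq ⟨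
    g ℤ.+ y ℤ.* n ℤ.+ ℤ.- (y ℤ.* n)  ≡⟨ cancel g (y ℤ.* n) ⟩
    g                                ∎
    where
    open ≡-Reasoning
    flip : ∀ m n x y → m ℤ.* x ℤ.+ n ℤ.* ℤ.- y ≡ x ℤ.* m ℤ.+ ℤ.- (y ℤ.* n)
    flip = solve-∀
    cancel : ∀ g z → g ℤ.+ z ℤ.+ ℤ.- z ≡ g
    cancel = solve-∀

  cast : ∀ g m n x y → g ℕ.+ y ℕ.* n ≡ x ℕ.* m → + g ℤ.+ + y ℤ.* + n ≡ + x ℤ.* + m
  cast g m n x y eq = trans (cong (ℤ._+_ (+ g)) (sym (ℤ.pos-* y n)))
    (trans (cong +_ eq) (ℤ.pos-* x m))

  -- The identity over ℕ avoids subtraction by having one constructor for each sign pattern; the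
  -- second case is the first with the roles of `m` and `n` exchanged.
  coefficients : Bézout.Identity g m n → ∃₂ λ x y → + m ℤ.* x ℤ.+ + n ℤ.* y ≡ + g
  coefficients (Bézout.+- x y eq) = + x , ℤ.- + y , rearrange (+ g) (+ m) (+ n) (+ x) (+ y) (cast g m n x y eq)
  coefficients (Bézout.-+ x y eq) = ℤ.- + x , + y , trans (ℤ.+-comm (+ m ℤ.* ℤ.- + x) (+ n ℤ.* + y))
    (rearrange (+ g) (+ n) (+ m) (+ y) (+ x) (cast g n m y x eq))

bézout-vector : ∀ {n} (r : Vector ℕ n) → ∃ λ g → (∀ i → g ℕ∣.∣ r i) ×
  ∃ λ a → ⟨ (λ i → + r i) , a ⟩ ≡ + g
-- The gcd of the empty family is 0.
bézout-vector {ℕ.zero}  r = 0 , (λ ()) , (λ ()) , refl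
bézout-vector {ℕ.suc n} r =
  let h , h∣ , a , eq = bézout-vector (tail r)
      g , g∣r₀ , g∣h , x , y , eq′ = bézout (r zero) h
  in g
   , (λ { zero → g∣r₀ ; (suc i) → ℕ∣.∣-trans g∣h (h∣ i) })
   , x ∷ (λ i → y ℤ.* a i)
   , trans (cong (ℤ._+_ (+ r zero ℤ.* x))
       (trans (⟨⟩-* (λ i → + r (suc i)) y a) (trans (cong (y ℤ.*_) eq) (ℤ.*-comm y (+ h))))) eq′

∣lcms : ∀ {n} (x : Vector ℕ n) i → x i ℕ∣.∣ lcms x
∣lcms x zero    = m∣lcm[m,n] (x zero) (lcms (tail x))
∣lcms x (suc i) = ℕ∣.∣-trans (∣lcms (tail x) i) (n∣lcm[m,n] (x zero) (lcms (tail x)))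

lcms-least : ∀ {n} (x : Vector ℕ n) {m} → (∀ i → x i ℕ∣.∣ m) → lcms x ℕ∣.∣ m
lcms-least {ℕ.zero}  x x∣m = ℕ∣.1∣ _
lcms-least {ℕ.suc n} x x∣m = lcm-least (x∣m zero) (lcms-least (tail x) (x∣m ∘ suc))

-- Arithmetic of the structure on the star.

module _ {n} (A : ArithmeticalStructure (starGraph n)) where
  open ArithmeticalStructure A

  private
    N : ℤ
    N = + r zero

    ρ δ : Vector ℤ n
    ρ i = + r (suc i)
    δ i = + d (suc i)

    Lᴬ : Matrix (ℕ.suc n) (ℕ.suc n)
    Lᴬ = L (starGraph n) d

    instance
      r₀-nonZero : ℕ.NonZero (r zero)
      r₀-nonZero = ℕ.>-nonZero (r-positive zero)

  leaf : ∀ i → r (suc i) ℕ.* d (suc i) ≡ r zero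
  leaf i = trans (arithmetical (suc i))
    (trans (cong₂ ℕ._+_ (ℕ.*-identityˡ (r zero)) (ℕΣ.sum-replicate-zero n)) (ℕ.+-identityʳ (r zero)))

  leafℤ : ∀ i → ρ i ℤ.* δ i ≡ N
  leafℤ i = trans (sym (ℤ.pos-* (r (suc i)) (d (suc i)))) (cong +_ (leaf i))

  d∣r₀ : ∀ i → d (suc i) ℕ∣.∣ r zero
  d∣r₀ i = ℕ∣.divides (r (suc i)) (sym (leaf i))

  δ∣N : ∀ i → δ i ℤ∣.∣ N
  δ∣N i = divides (ρ i) (sym (leafℤ i))

  -- This is the arithmetical equation at the centre. Modulo `N` it says B(s, s) = 0.
  ⟨ρ,𝟙⟩ : ⟨ ρ , 𝟙 ⟩ ≡ N ℤ.* + d zero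
  ⟨ρ,𝟙⟩ = begin
    ⟨ ρ , 𝟙 ⟩                                  ≡⟨ ℤΣ.sum-cong-≗ (λ i → ℤ.*-identityʳ (ρ i)) ⟩
    ℤΣ.sum ρ                                   ≡⟨ pos-∑ (λ i → r (suc i)) ⟨
    + ℕΣ.sum (λ i → r (suc i))                 ≡⟨ cong +_ (ℕΣ.sum-cong-≗ λ i → ℕ.*-identityˡ (r (suc i))) ⟨
    + (ℕΣ.sum (λ i → 1 ℕ.* r (suc i)))         ≡⟨ cong +_ (arithmetical zero) ⟨
    + (r zero ℕ.* d zero)                      ≡⟨ ℤ.pos-* (r zero) (d zero) ⟩
    N ℤ.* + d zero                             ∎
    where open ≡-Reasoning

  -- Write `r zero` as k l with l the lcm. Since l = m dᵢ, cancelling dᵢ from ρᵢ dᵢ = k m dᵢ shows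
  -- that k divides every ρᵢ, so coprimality forces k = 1. The cancellation is legitimate because ρᵢ
  -- dᵢ = `r zero` is positive.
  r₀≡lcms : r zero ≡ lcms (λ i → d (suc i))
  r₀≡lcms with lcms-least (λ i → d (suc i)) d∣r₀
  ... | ℕ∣.divides k r₀≡k*l =
    trans r₀≡k*l (trans (cong (ℕ._* l) (r-coprime k k∣r)) (ℕ.*-identityˡ l))
    where
    l = lcms (λ i → d (suc i))

    k∣r : ∀ v → k ℕ∣.∣ r v
    k∣r zero    = ℕ∣.divides l (trans r₀≡k*l (ℕ.*-comm k l))
    k∣r (suc i) with ∣lcms (λ i → d (suc i)) i
    ... | ℕ∣.divides m l≡m*d = ℕ∣.divides m (ℕ.*-cancelʳ-≡ (r (suc i)) (m ℕ.* k) (d (suc i)) {{dᵢ≢0}} (begin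
      r (suc i) ℕ.* d (suc i)      ≡⟨ leaf i ⟩
      r zero                       ≡⟨ r₀≡k*l ⟩
      k ℕ.* l                      ≡⟨ cong (k ℕ.*_) l≡m*d ⟩
      k ℕ.* (m ℕ.* d (suc i))      ≡⟨ ℕ.*-assoc k m (d (suc i)) ⟨
      k ℕ.* m ℕ.* d (suc i)        ≡⟨ cong (ℕ._* d (suc i)) (ℕ.*-comm k m) ⟩
      m ℕ.* k ℕ.* d (suc i)        ∎))
      where
      open ≡-Reasoning
      dᵢ≢0 : ℕ.NonZero (d (suc i))
      dᵢ≢0 = ℕ.m*n≢0⇒n≢0 (r (suc i)) {{subst ℕ.NonZero (sym (leaf i)) r₀-nonZero}}

  -- Coprimality is assumed for all of `r`, centre included. A common divisor of the leaf values
  -- divides `r zero` too, since that is a multiple of the first leaf value; this is where a leaf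
  -- must exist.
  leaf-bézout : n ≥ 1 → ∃ λ a → ⟨ ρ , a ⟩ ≡ 1ℤ
  leaf-bézout (ℕ.s≤s _) with bézout-vector (λ i → r (suc i))
  ... | g , g∣r , a , eq = a , trans eq (cong +_ (r-coprime g λ where
    zero    → ℕ∣.∣-trans (g∣r zero) (ℕ∣.divides (d (suc zero))
                (trans (sym (leaf zero)) (ℕ.*-comm (r (suc zero)) (d (suc zero)))))
    (suc i) → g∣r i))

  -- The image of the Laplacian.

  L-centre : ∀ x → (Lᴬ *ᵥ x) zero ≡ + d zero ℤ.* x zero ℤ.+ ℤ.- ⟨ 𝟙 , tail x ⟩
  L-centre x = cong₂ ℤ._+_ (cong (ℤ._* x zero) (ℤ.+-identityʳ (+ d zero))) (begin
    ℤΣ.∑[ j < n ] (ℤ.-1ℤ ℤ.* x (suc j))  ≡⟨ ℤΣ.*-distribˡ-sum ℤ.-1ℤ (tail x) ⟨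
    ℤ.-1ℤ ℤ.* ℤΣ.sum (tail x)            ≡⟨ ℤ.-1*i≡-i (ℤΣ.sum (tail x)) ⟩
    ℤ.- ℤΣ.sum (tail x)                  ≡⟨ cong ℤ.-_ (ℤΣ.sum-cong-≗ λ j → ℤ.*-identityˡ (x (suc j))) ⟨
    ℤ.- ⟨ 𝟙 , tail x ⟩                   ∎)
    where open ≡-Reasoning

  L-leaf : ∀ x i → (Lᴬ *ᵥ x) (suc i) ≡ x (suc i) ℤ.* δ i ℤ.+ ℤ.- x zero
  L-leaf x i = trans (cong₂ ℤ._+_ (ℤ.-1*i≡-i (x zero)) (∑-indicator i (δ i) (tail x)))
    (trans (ℤ.+-comm (ℤ.- x zero) (δ i ℤ.* x (suc i)))
      (cong (ℤ._+ ℤ.- x zero) (ℤ.*-comm (δ i) (x (suc i)))))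

  leaf-preimage : ∀ (y x : Vector ℤ (ℕ.suc n)) → (∀ v → y v ≡ (Lᴬ *ᵥ x) v) →
    ∀ i → y (suc i) ℤ.+ x zero ≡ x (suc i) ℤ.* δ i
  leaf-preimage y x y≗Lx i = trans (cong (ℤ._+ x zero) (trans (y≗Lx (suc i)) (L-leaf x i)))
    (cancel (x (suc i) ℤ.* δ i) (x zero))
    where
    cancel : ∀ p x → p ℤ.+ ℤ.- x ℤ.+ x ≡ p
    cancel = solve-∀

  -- Each summand is tᵢ qᵢ ρᵢ δᵢ, and ρᵢ δᵢ = `N`. Modulo `N` this is the well-definedness of B; the
  -- exact value over ℤ is kept for `leaf-sum`.
  weighted-sum : ∀ (t e q : Vector ℤ n) → (∀ i → e i ≡ q i ℤ.* δ i) →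
    ⟨ (λ i → ρ i ℤ.* t i) , e ⟩ ≡ ⟨ t , q ⟩ ℤ.* N
  weighted-sum t e q e≗qδ = begin
    ⟨ (λ i → ρ i ℤ.* t i) , e ⟩             ≡⟨ ℤΣ.sum-cong-≗ step ⟩
    ℤΣ.sum (λ i → (t i ℤ.* q i) ℤ.* N)      ≡⟨ ℤΣ.*-distribʳ-sum N (λ i → t i ℤ.* q i) ⟨
    ⟨ t , q ⟩ ℤ.* N                         ∎
    where
    open ≡-Reasoning
    regroup : ∀ p t q s → (p ℤ.* t) ℤ.* (q ℤ.* s) ≡ (t ℤ.* q) ℤ.* (p ℤ.* s)
    regroup = solve-∀
    step : ∀ i → (ρ i ℤ.* t i) ℤ.* e i ≡ (t i ℤ.* q i) ℤ.* N
    step i = trans (cong ((ρ i ℤ.* t i) ℤ.*_) (e≗qδ i))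
      (trans (regroup (ρ i) (t i) (q i) (δ i)) (cong ((t i ℤ.* q i) ℤ.*_) (leafℤ i)))

  N∣weighted-sum : ∀ (t e : Vector ℤ n) → (∀ i → δ i ℤ∣.∣ e i) →
    N ℤ∣.∣ ⟨ (λ i → ρ i ℤ.* t i) , e ⟩
  N∣weighted-sum t e δ∣e = divides ⟨ t , ℤ∣.quotient ∘ δ∣e ⟩
    (weighted-sum t e (ℤ∣.quotient ∘ δ∣e) (ℤ∣._∣_.equality ∘ δ∣e))

  ρ*𝟙 : ∀ e → ⟨ (λ i → ρ i ℤ.* 1ℤ) , e ⟩ ≡ ⟨ ρ , e ⟩
  ρ*𝟙 e = ℤΣ.sum-cong-≗ λ i → cong (ℤ._* e i) (ℤ.*-identityʳ (ρ i))

  -- Pairing y + c s with s, as an exact equation over ℤ. It links the leaf rows of `Lᴬ` to the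
  -- central one, with `c` the central and `q` the leaf coordinates of a preimage.
  leaf-sum : ∀ y c q → (∀ i → y i ℤ.+ c ≡ q i ℤ.* δ i) →
    ⟨ ρ , y ⟩ ℤ.+ c ℤ.* (N ℤ.* + d zero) ≡ ⟨ 𝟙 , q ⟩ ℤ.* N
  leaf-sum y c q eq = begin
    ⟨ ρ , y ⟩ ℤ.+ c ℤ.* (N ℤ.* + d zero)          ≡⟨ cong (λ z → ⟨ ρ , y ⟩ ℤ.+ c ℤ.* z) ⟨ρ,𝟙⟩ ⟨
    ⟨ ρ , y ⟩ ℤ.+ c ℤ.* ⟨ ρ , 𝟙 ⟩                 ≡⟨ ⟨⟩-+* ρ y c 𝟙 ⟨
    ⟨ ρ , (λ i → y i ℤ.+ c ℤ.* 1ℤ) ⟩              ≡⟨ ρ*𝟙 _ ⟨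
    ⟨ (λ i → ρ i ℤ.* 1ℤ) , (λ i → y i ℤ.+ c ℤ.* 1ℤ) ⟩
      ≡⟨ weighted-sum 𝟙 _ q (λ i → trans (cong (ℤ._+_ (y i)) (ℤ.*-identityʳ c)) (eq i)) ⟩
    ⟨ 𝟙 , q ⟩ ℤ.* N                               ∎
    where open ≡-Reasoning

  degree : Vector ℤ (ℕ.suc n) → ℤ
  degree y = ⟨ (λ v → + r v) , y ⟩

  -- `Lᴬ` is symmetric and the arithmetical equations say that it kills `r`, so `r` pairs to 0 with
  -- its image.
  image⇒degree≡0 : ∀ {y} → InImage Lᴬ y → degree y ≡ 0ℤ
  image⇒degree≡0 {y} (x , y≗Lx) = begin
    N ℤ.* y zero ℤ.+ ⟨ ρ , tail y ⟩
      ≡⟨ cong (λ z → N ℤ.* z ℤ.+ ⟨ ρ , tail y ⟩) (trans (y≗Lx zero) (L-centre x)) ⟩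
    N ℤ.* (+ d zero ℤ.* x zero ℤ.+ ℤ.- ⟨ 𝟙 , tail x ⟩) ℤ.+ ⟨ ρ , tail y ⟩
      ≡⟨ regroup N (+ d zero) (x zero) ⟨ 𝟙 , tail x ⟩ ⟨ ρ , tail y ⟩ ⟩
    (⟨ ρ , tail y ⟩ ℤ.+ x zero ℤ.* (N ℤ.* + d zero)) ℤ.+ ℤ.- (⟨ 𝟙 , tail x ⟩ ℤ.* N)
      ≡⟨ cong (ℤ._+ ℤ.- (⟨ 𝟙 , tail x ⟩ ℤ.* N)) (leaf-sum (tail y) (x zero) (tail x) (leaf-preimage y x y≗Lx)) ⟩
    ⟨ 𝟙 , tail x ⟩ ℤ.* N ℤ.+ ℤ.- (⟨ 𝟙 , tail x ⟩ ℤ.* N)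
      ≡⟨ ℤ.+-inverseʳ (⟨ 𝟙 , tail x ⟩ ℤ.* N) ⟩
    0ℤ ∎
    where
    open ≡-Reasoning
    regroup : ∀ N d x s p → N ℤ.* (d ℤ.* x ℤ.+ ℤ.- s) ℤ.+ p ≡ (p ℤ.+ x ℤ.* (N ℤ.* d)) ℤ.+ ℤ.- (s ℤ.* N)
    regroup = solve-∀

  -- The central coordinate of a preimage shifts all leaves by the same amount, which is the
  -- ambiguity by multiples of s.
  image⇒leaves-congruent : ∀ {y} → InImage Lᴬ y → ∃ λ c → ∀ i → δ i ℤ∣.∣ y (suc i) ℤ.+ c
  image⇒leaves-congruent {y} (x , y≗Lx) = x zero , λ i → divides (x (suc i)) (leaf-preimage y x y≗Lx i)

  -- The preimage is `c ∷ q` with `q` the quotients of the divisibilities, so the leaf rows hold by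
  -- construction. The central row holds after multiplication by `N`, by `leaf-sum` and the
  -- vanishing degree, and `N` is nonzero.
  image-criterion : ∀ {y} c → degree y ≡ 0ℤ → (∀ i → δ i ℤ∣.∣ y (suc i) ℤ.+ c) → InImage Lᴬ y
  image-criterion {y} c deg≡0 δ∣y+c = c ∷ q , λ where
      zero    → trans centre (sym (L-centre (c ∷ q)))
      (suc i) → trans (shift (y (suc i)) c)
        (trans (cong (ℤ._+ ℤ.- c) (ℤ∣._∣_.equality (δ∣y+c i))) (sym (L-leaf (c ∷ q) i)))
    where
    open ≡-Reasoning
    q : Vector ℤ n
    q i = ℤ∣.quotient (δ∣y+c i)

    shift : ∀ y c → y ≡ y ℤ.+ c ℤ.+ ℤ.- c
    shift = solve-∀

    regroup₁ : ∀ N d c y p → N ℤ.* y ≡ (N ℤ.* y ℤ.+ p) ℤ.+ (N ℤ.* (d ℤ.* c) ℤ.+ ℤ.- (p ℤ.+ c ℤ.* (N ℤ.* d)))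
    regroup₁ = solve-∀

    regroup₂ : ∀ N d c s → 0ℤ ℤ.+ (N ℤ.* (d ℤ.* c) ℤ.+ ℤ.- (s ℤ.* N)) ≡ N ℤ.* (d ℤ.* c ℤ.+ ℤ.- s)
    regroup₂ = solve-∀

    centre : y zero ≡ + d zero ℤ.* c ℤ.+ ℤ.- ⟨ 𝟙 , q ⟩
    centre = ℤ.*-cancelˡ-≡ N _ _ (begin
      N ℤ.* y zero
        ≡⟨ regroup₁ N (+ d zero) c (y zero) ⟨ ρ , tail y ⟩ ⟩
      degree y ℤ.+ (N ℤ.* (+ d zero ℤ.* c) ℤ.+ ℤ.- (⟨ ρ , tail y ⟩ ℤ.+ c ℤ.* (N ℤ.* + d zero)))
        ≡⟨ cong₂ (λ u v → u ℤ.+ (N ℤ.* (+ d zero ℤ.* c) ℤ.+ ℤ.- v)) deg≡0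
             (leaf-sum (tail y) c q (ℤ∣._∣_.equality ∘ δ∣y+c)) ⟩
      0ℤ ℤ.+ (N ℤ.* (+ d zero ℤ.* c) ℤ.+ ℤ.- (⟨ 𝟙 , q ⟩ ℤ.* N))
        ≡⟨ regroup₂ N (+ d zero) c ⟨ 𝟙 , q ⟩ ⟩
      N ℤ.* (+ d zero ℤ.* c ℤ.+ ℤ.- ⟨ 𝟙 , q ⟩) ∎)

  -- Torsion in the cokernel.

  open import Algebra.Definitions.RawMonoid (AbelianGroup.rawMonoid (cokernel Lᴬ))
    using () renaming (_×_ to _·_)

  -- The quotient keeps the carrier and operation of ℤⁿ⁺¹, so multiples in the cokernel are integer
  -- multiples of representatives on the nose.
  ·-pointwise : ∀ k y v → (k · y) v ≡ + k ℤ.* y v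
  ·-pointwise ℕ.zero    y v = refl
  ·-pointwise (ℕ.suc k) y v = trans (cong (ℤ._+_ (y v)) (·-pointwise k y v)) (sym (ℤ.suc-* (+ k) (y v)))

  -- `degree` is linear and vanishes on the image, and ℤ is torsion-free.
  torsion⇒degree≡0 : ∀ y → IsTorsion (cokernel Lᴬ) y → degree y ≡ 0ℤ
  torsion⇒degree≡0 y (k , im) = ℤ.*-cancelˡ-≡ (+ ℕ.suc k) (degree y) 0ℤ (begin
    + ℕ.suc k ℤ.* degree y                     ≡⟨ ⟨⟩-* (λ v → + r v) (+ ℕ.suc k) y ⟨
    degree (λ v → + ℕ.suc k ℤ.* y v)           ≡⟨ ⟨⟩-congʳ (λ v → + r v) (λ v →
      trans (ℤ.+-identityʳ _) (·-pointwise (ℕ.suc k) y v)) ⟨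
    -- Being equal to the identity of a quotient unfolds to membership of the difference with 0,
    -- which leaves a trailing `0ℤ` here and below.
    degree (λ v → (ℕ.suc k · y) v ℤ.+ 0ℤ)      ≡⟨ image⇒degree≡0 im ⟩
    0ℤ                                         ≡⟨ ℤ.*-zeroʳ (+ ℕ.suc k) ⟨
    + ℕ.suc k ℤ.* 0ℤ                           ∎)
    where open ≡-Reasoning

  -- `N` annihilates such a `y`: every δᵢ divides `N`, so `image-criterion` applies to the multiple
  -- with shift 0.
  degree≡0⇒torsion : ∀ y → degree y ≡ 0ℤ → IsTorsion (cokernel Lᴬ) y
  -- `IsTorsion` stores the predecessor of the annihilating multiple.
  degree≡0⇒torsion y deg≡0 = ℕ.pred (r zero) ,
    IsSubgroup.resp (image-isSubgroup Lᴬ) scale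
      (image-criterion 0ℤ
        (trans (⟨⟩-* (λ v → + r v) N y) (trans (cong (N ℤ.*_) deg≡0) (ℤ.*-zeroʳ N)))
        (λ i → subst (δ i ℤ∣.∣_) (sym (ℤ.+-identityʳ _)) (ℤ∣.∣m⇒∣m*n (y (suc i)) (δ∣N i))))
    where
    scale : ∀ v → N ℤ.* y v ≡ (ℕ.suc (ℕ.pred (r zero)) · y) v ℤ.+ 0ℤ
    scale v = sym (trans (ℤ.+-identityʳ _) (trans (·-pointwise (ℕ.suc (ℕ.pred (r zero))) y v)
      (cong (λ m → + m ℤ.* y v) (ℕ.suc-pred (r zero)))))

  -- Splitting off the span of s and a.

  module Splitting (a : Vector ℤ n) (⟨ρ,a⟩≡1 : ⟨ ρ , a ⟩ ≡ 1ℤ) where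
    private
      module K = AbelianGroup (criticalGroup A ⊕ (ℤ/ r zero ⊕ ℤ/ r zero))
      module M = AbelianGroup (⨁ (λ i → ℤ/ d (suc i)))

    -- Pairing with this vector is B(a, -).
    ρa : Vector ℤ n
    ρa i = ρ i ℤ.* a i

    ⟨ρa,𝟙⟩≡1 : ⟨ ρa , 𝟙 ⟩ ≡ 1ℤ
    ⟨ρa,𝟙⟩≡1 = trans (ℤΣ.sum-cong-≗ λ i → ℤ.*-identityʳ (ρa i)) ⟨ρ,a⟩≡1

    -- The projection y - B(a, y) s of s^⊥ onto ⟨s, a⟩^⊥, plus u s + v a.
    assemble : Vector ℤ n → ℤ → ℤ → Vector ℤ n
    assemble y u v i = (y i ℤ.+ (u ℤ.+ ℤ.- ⟨ ρa , y ⟩)) ℤ.+ v ℤ.* a i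

    assemble-+ : ∀ y u v y′ u′ v′ i →
      assemble (λ j → y j ℤ.+ y′ j) (u ℤ.+ u′) (v ℤ.+ v′) i ≡ assemble y u v i ℤ.+ assemble y′ u′ v′ i
    assemble-+ y u v y′ u′ v′ i = trans
      (cong (λ b → (y i ℤ.+ y′ i ℤ.+ ((u ℤ.+ u′) ℤ.+ ℤ.- b)) ℤ.+ (v ℤ.+ v′) ℤ.* a i) (⟨⟩-+ ρa y y′))
      (regroup (y i) (y′ i) u u′ ⟨ ρa , y ⟩ ⟨ ρa , y′ ⟩ v v′ (a i))
      where
      regroup : ∀ y y′ u u′ b b′ v v′ a →
        (y ℤ.+ y′ ℤ.+ ((u ℤ.+ u′) ℤ.+ ℤ.- (b ℤ.+ b′))) ℤ.+ (v ℤ.+ v′) ℤ.* a ≡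
        ((y ℤ.+ (u ℤ.+ ℤ.- b)) ℤ.+ v ℤ.* a) ℤ.+ ((y′ ℤ.+ (u′ ℤ.+ ℤ.- b′)) ℤ.+ v′ ℤ.* a)
      regroup = solve-∀

    -- Stated for arbitrary `w` because the kernel computation takes both `ρ` and `ρa`, that is,
    -- pairs with s and with a.
    ⟨⟩-assemble : ∀ w y u v → ⟨ w , assemble y u v ⟩ ≡
      (⟨ w , y ⟩ ℤ.+ (u ℤ.+ ℤ.- ⟨ ρa , y ⟩) ℤ.* ⟨ w , 𝟙 ⟩) ℤ.+ v ℤ.* ⟨ w , a ⟩
    ⟨⟩-assemble w y u v = begin
      ⟨ w , assemble y u v ⟩
        ≡⟨ ⟨⟩-+* w (λ i → y i ℤ.+ c) v a ⟩
      ⟨ w , (λ i → y i ℤ.+ c) ⟩ ℤ.+ v ℤ.* ⟨ w , a ⟩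
        ≡⟨ cong (ℤ._+ v ℤ.* ⟨ w , a ⟩) (⟨⟩-congʳ w λ i → cong (ℤ._+_ (y i)) (ℤ.*-identityʳ c)) ⟨
      ⟨ w , (λ i → y i ℤ.+ c ℤ.* 1ℤ) ⟩ ℤ.+ v ℤ.* ⟨ w , a ⟩
        ≡⟨ cong (ℤ._+ v ℤ.* ⟨ w , a ⟩) (⟨⟩-+* w y c 𝟙) ⟩
      (⟨ w , y ⟩ ℤ.+ c ℤ.* ⟨ w , 𝟙 ⟩) ℤ.+ v ℤ.* ⟨ w , a ⟩ ∎
      where
      open ≡-Reasoning
      c = u ℤ.+ ℤ.- ⟨ ρa , y ⟩

    -- With c the common shift of the leaves, y - b s = (y + c s) - (b + c) s. The first term is 0
    -- in M, and `N` divides b + c. The `u` and `v` terms vanish because δᵢ divides `N`.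
    assemble-null : ∀ y u v → InImage Lᴬ y → N ℤ∣.∣ u → N ℤ∣.∣ v →
      ∀ i → δ i ℤ∣.∣ assemble (tail y) u v i
    assemble-null y u v im N∣u N∣v i with image⇒leaves-congruent im
    ... | c , δ∣y+c = subst (δ i ℤ∣.∣_) (regroup (y (suc i)) c u b v (a i))
      (ℤ∣.∣m∣n⇒∣m+n
        (ℤ∣.∣m∣n⇒∣m+n (δ∣y+c i) (ℤ∣.∣-trans (δ∣N i) (ℤ∣.∣m∣n⇒∣m+n N∣u (ℤ∣.∣m⇒∣-m N∣b+c))))
        (ℤ∣.∣m⇒∣m*n (a i) (ℤ∣.∣-trans (δ∣N i) N∣v)))
      where
      b = ⟨ ρa , tail y ⟩

      -- Since B(a, s) = 1, b + c is B(a, y + c s), and y + c s is 0 in M.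
      N∣b+c : N ℤ∣.∣ b ℤ.+ c
      N∣b+c = subst (N ℤ∣.∣_)
        (trans (⟨⟩-+* ρa (tail y) c 𝟙)
          (cong (ℤ._+_ b) (trans (cong (c ℤ.*_) ⟨ρa,𝟙⟩≡1) (ℤ.*-identityʳ c))))
        (N∣weighted-sum a _ λ j →
          subst (λ z → δ j ℤ∣.∣ y (suc j) ℤ.+ z) (sym (ℤ.*-identityʳ c)) (δ∣y+c j))

      regroup : ∀ y c u b v a →
        (y ℤ.+ c ℤ.+ (u ℤ.+ ℤ.- (b ℤ.+ c))) ℤ.+ v ℤ.* a ≡ (y ℤ.+ (u ℤ.+ ℤ.- b)) ℤ.+ v ℤ.* a
      regroup = solve-∀

    -- The order matters. Pairing with s isolates `v`, as s is isotropic and degree 0 makes ⟨ρ, y⟩ a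
    -- multiple of `N`. Pairing with a then isolates `u` up to a multiple of `v`, and both vanish
    -- before `y` is treated.
    module Kernel y u v (deg≡0 : degree y ≡ 0ℤ) (δ∣ : ∀ i → δ i ℤ∣.∣ assemble (tail y) u v i) where
      private b = ⟨ ρa , tail y ⟩

      -- Pairing with s.
      kernel-v : N ℤ∣.∣ v
      kernel-v = subst (N ℤ∣.∣_) (sym eq) (ℤ∣.∣m∣n⇒∣m+n
          (subst (N ℤ∣.∣_) (ρ*𝟙 _) (N∣weighted-sum 𝟙 _ δ∣))
          (ℤ∣.∣m⇒∣m*n (y zero ℤ.+ ℤ.- ((u ℤ.+ ℤ.- b) ℤ.* + d zero)) ℤ∣.∣-refl))
        where
        open ≡-Reasoning
        regroup : ∀ p y N c d v → v ≡
          (((p ℤ.+ c ℤ.* (N ℤ.* d)) ℤ.+ v ℤ.* 1ℤ) ℤ.+ N ℤ.* (y ℤ.+ ℤ.- (c ℤ.* d))) ℤ.+ ℤ.- (N ℤ.* y ℤ.+ p)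
        regroup = solve-∀
        eq : v ≡ ⟨ ρ , assemble (tail y) u v ⟩ ℤ.+ N ℤ.* (y zero ℤ.+ ℤ.- ((u ℤ.+ ℤ.- b) ℤ.* + d zero))
        eq = begin
          v
            ≡⟨ regroup ⟨ ρ , tail y ⟩ (y zero) N (u ℤ.+ ℤ.- b) (+ d zero) v ⟩
          (((⟨ ρ , tail y ⟩ ℤ.+ (u ℤ.+ ℤ.- b) ℤ.* (N ℤ.* + d zero)) ℤ.+ v ℤ.* 1ℤ) ℤ.+ X) ℤ.+ ℤ.- degree y
            ≡⟨ cong₂ (λ p q → (((⟨ ρ , tail y ⟩ ℤ.+ (u ℤ.+ ℤ.- b) ℤ.* p) ℤ.+ v ℤ.* q) ℤ.+ X) ℤ.+ ℤ.- degree y)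
                 ⟨ρ,𝟙⟩ ⟨ρ,a⟩≡1 ⟨
          (((⟨ ρ , tail y ⟩ ℤ.+ (u ℤ.+ ℤ.- b) ℤ.* ⟨ ρ , 𝟙 ⟩) ℤ.+ v ℤ.* ⟨ ρ , a ⟩) ℤ.+ X) ℤ.+ ℤ.- degree y
            ≡⟨ cong₂ (λ p q → (p ℤ.+ X) ℤ.+ ℤ.- q) (sym (⟨⟩-assemble ρ (tail y) u v)) deg≡0 ⟩
          (⟨ ρ , assemble (tail y) u v ⟩ ℤ.+ X) ℤ.+ 0ℤ
            ≡⟨ ℤ.+-identityʳ _ ⟩
          ⟨ ρ , assemble (tail y) u v ⟩ ℤ.+ X ∎
          where
          X = N ℤ.* (y zero ℤ.+ ℤ.- ((u ℤ.+ ℤ.- b) ℤ.* + d zero))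

      -- Pairing with a.
      kernel-u : N ℤ∣.∣ u
      kernel-u = ℤ∣.∣m+n∣n⇒∣m {m = u} {n = v ℤ.* ⟨ ρa , a ⟩}
        (subst (N ℤ∣.∣_) eq (N∣weighted-sum a _ δ∣)) (ℤ∣.∣m⇒∣m*n ⟨ ρa , a ⟩ kernel-v)
        where
        regroup : ∀ b u v → (b ℤ.+ (u ℤ.+ ℤ.- b) ℤ.* 1ℤ) ℤ.+ v ≡ u ℤ.+ v
        regroup = solve-∀
        eq : ⟨ ρa , assemble (tail y) u v ⟩ ≡ u ℤ.+ v ℤ.* ⟨ ρa , a ⟩
        eq = trans (⟨⟩-assemble ρa (tail y) u v)
          (trans (cong (λ p → (b ℤ.+ (u ℤ.+ ℤ.- b) ℤ.* p) ℤ.+ v ℤ.* ⟨ ρa , a ⟩) ⟨ρa,𝟙⟩≡1)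
            (regroup b u (v ℤ.* ⟨ ρa , a ⟩)))

      -- Once the multiples of `N` are discarded, y - b s remains, so the common shift of the leaves
      -- is -b.
      kernel-y : InImage Lᴬ y
      kernel-y = image-criterion (ℤ.- b) deg≡0 λ i →
        subst (δ i ℤ∣.∣_) (regroup (y (suc i)) u b (v ℤ.* a i))
          (ℤ∣.∣m∣n⇒∣m-n (δ∣ i) (ℤ∣.∣m∣n⇒∣m+n (ℤ∣.∣-trans (δ∣N i) kernel-u)
            (ℤ∣.∣m⇒∣m*n (a i) (ℤ∣.∣-trans (δ∣N i) kernel-v))))
        where
        regroup : ∀ y u b z → ((y ℤ.+ (u ℤ.+ ℤ.- b)) ℤ.+ z) ℤ.+ ℤ.- (u ℤ.+ z) ≡ y ℤ.+ ℤ.- b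
        regroup = solve-∀

    -- Take v = B(s, z) and y = z - v a, which pairs to 0 with s because B(s, a) = 1; then u = B(a,
    -- y) undoes the projection. The pairing is 0 over ℤ, not only modulo `N`, so 0 serves as
    -- central coordinate.
    assemble-surjective : ∀ z → ∃₂ λ y u → ∃ λ v →
      degree (0ℤ ∷ y) ≡ 0ℤ × (∀ i → assemble y u v i ≡ z i)
    assemble-surjective z = y , ⟨ ρa , y ⟩ , v , deg≡0 ,
      λ i → regroup (z i) v (a i) ⟨ ρa , y ⟩
      where
      v = ⟨ ρ , z ⟩
      y : Vector ℤ n
      y i = z i ℤ.+ ℤ.- v ℤ.* a i

      regroup : ∀ z v a b → ((z ℤ.+ ℤ.- v ℤ.* a) ℤ.+ (b ℤ.+ ℤ.- b)) ℤ.+ v ℤ.* a ≡ z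
      regroup = solve-∀

      cancel : ∀ N v → N ℤ.* 0ℤ ℤ.+ (v ℤ.+ ℤ.- v ℤ.* 1ℤ) ≡ 0ℤ
      cancel = solve-∀

      deg≡0 : degree (0ℤ ∷ y) ≡ 0ℤ
      deg≡0 = trans (cong (ℤ._+_ (N ℤ.* 0ℤ))
        (trans (⟨⟩-+* ρ z (ℤ.- v) a) (cong (λ p → v ℤ.+ ℤ.- v ℤ.* p) ⟨ρ,a⟩≡1))) (cancel N v)

    -- Dropping `y zero` loses nothing: degree 0 determines it from the leaves, as `N` is nonzero.
    φ : K.Carrier → M.Carrier
    φ ((y , _) , u , v) = assemble (tail y) u v

    ≡⇒≈ : ∀ {x y : M.Carrier} → (∀ i → x i ≡ y i) → x M.≈ y
    ≡⇒≈ {x} x≗y i = subst (λ z → δ i ℤ∣.∣ x i ℤ.- z) (x≗y i) (M.refl {x} i)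

    splitting : criticalGroup A ⊕ (ℤ/ r zero ⊕ ℤ/ r zero) ≅ ⨁ (λ i → ℤ/ d (suc i))
    splitting = φ , additive⇒isomorphism
      (criticalGroup A ⊕ (ℤ/ r zero ⊕ ℤ/ r zero)) (⨁ (λ i → ℤ/ d (suc i))) φ
      (λ { ((y , _) , u , v) ((y′ , _) , u′ , v′) →
             ≡⇒≈ (assemble-+ (tail y) u v (tail y′) u′ v′) })
      (λ { ((y , t) , u , v) (im , N∣u , N∣v) i → ∣⇒∣+0 (φ ((y , t) , u , v) i) (assemble-null y u v
             (IsSubgroup.resp (image-isSubgroup Lᴬ) (λ w → ℤ.+-identityʳ (y w)) im)
             (∣+0⇒∣ u N∣u) (∣+0⇒∣ v N∣v) i) })
      (λ { ((y , t) , u , v) e → let open Kernel y u v (torsion⇒degree≡0 y t)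
                                           (λ i → ∣+0⇒∣ (φ ((y , t) , u , v) i) (e i)) in
             IsSubgroup.resp (image-isSubgroup Lᴬ) (λ w → sym (ℤ.+-identityʳ (y w))) kernel-y
           , ∣⇒∣+0 u kernel-u , ∣⇒∣+0 v kernel-v })
      (λ z → let y , u , v , deg≡0 , eq = assemble-surjective z in
             ((0ℤ ∷ y , degree≡0⇒torsion (0ℤ ∷ y) deg≡0) , u , v) , ≡⇒≈ eq)
      where
      ∣⇒∣+0 : ∀ {k} x → k ℤ∣.∣ x → k ℤ∣.∣ x ℤ.+ 0ℤ
      ∣⇒∣+0 {k} x = subst (k ℤ∣.∣_) (sym (ℤ.+-identityʳ x))

      ∣+0⇒∣ : ∀ {k} x → k ℤ∣.∣ x ℤ.+ 0ℤ → k ℤ∣.∣ x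
      ∣+0⇒∣ {k} x = subst (k ℤ∣.∣_) (ℤ.+-identityʳ x)

theorem1 : (n : ℕ) → n ≥ 1 → (A : ArithmeticalStructure (starGraph n)) →
    let open ArithmeticalStructure A in
    (r zero ≡ lcms (λ i → d (suc i))) ×
    (criticalGroup A ⊕ (ℤ/ r zero ⊕ ℤ/ r zero) ≅ ⨁ (λ i → ℤ/ d (suc i)))
theorem1 n n≥1 A = let a , ⟨ρ,a⟩≡1 = leaf-bézout A n≥1 in
  r₀≡lcms A , Splitting.splitting A a ⟨ρ,a⟩≡1
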